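{- If $G$ and $H$ are (disjoint) graphs and $G+H$ denotes their join, then \[ \mathrm{gp}(G+H)=\max\{\omega(G)+\omega(H),\,\eta(G),\,\eta(H)\}=\max\{\omega(G)+\omega(H),\,\rho(G),\,\rho(H)\}. \]
   Context: Graphs are finite, undirected, simple and have at least one vertex. The join $G+H$ of disjoint graphs $G$ and $H$ has vertex set $V(G)\cup V(H)$ and edge set $E(G)\cup E(H)\cup\{xy:\ x\in V(G),\,y\in V(H)\}$. $\omega(G)$ is the number of vertices of a largest complete subgraph of $G$. $\eta(G)$ is the maximum order of an induced complete multipartite subgraph of the complement $\overline{G}$, where a complete multipartite graph is taken to have at least two (nonempty) partite sets, and $\eta(G)=0$ if no such induced subgraph exists. For a graph $G$, $d_G$ is the shortest-path distance, taken as infinite between different components. Complete subgraphs $Q$ and $Q'$ of $G$ are independent if $d_G(u,u')\ge 2$ for every $u\in V(Q)$ and every $u'\in V(Q')$. $\rho(G)$ denotes the maximum number of vertices in a union of pairwise independent complete subgraphs of $G$ (the union of a single complete subgraph being allowed). A $u,v$-geodesic is a $u,v$-path of length $d_G(u,v)$. A set $S\subseteq V(G)$ is a general position set of $G$ if no vertex of $S$ lies on a geodesic between two other vertices of $S$. The general position number $\mathrm{gp}(G)$ is the maximum cardinality of a general position set of $G$. -}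

module Defs where

open import Data.Fin using (Fin; splitAt)
open import Data.Fin.Properties using (_≟_; all?)
open import Data.Fin.Subset using (Subset; inside; outside; ∣_∣; Nonempty; Empty; ⋃; _∪_; _∩_)
  renaming (_∈_ to _∈ˢ_; _∉_ to _∉ˢ_)
open import Data.Fin.Subset.Properties
  using (nonempty?; ∣p∣≤n; p⊂q⇒∣p∣<∣q∣; p⊆p∪q; q⊆p∪q; x∈p∪q⁻; x∈p∩q⁺; x∈p∩q⁻; ∉⊥)
  renaming (_∈?_ to _∈ˢ?_)
open import Data.List using (List; []; _∷_; map; filter; find; upTo; applyUpTo; length; cartesianProductWith; allFin)
open import Data.List.Extrema.Nat using (max)
open import Data.List.Membership.Propositional using (lose) renaming (_∈_ to _∈ˡ_)
open import Data.List.Membership.Propositional.Properties using (∈-cartesianProductWith⁺; ∈-allFin; ∈-upTo⁻)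
open import Data.List.Relation.Unary.All as All using (All; []; _∷_)
open import Data.List.Relation.Unary.AllPairs as AllPairs using (AllPairs; []; _∷_; allPairs?)
open import Data.List.Relation.Unary.Any as Any using (here; there)
open import Data.Nat using (ℕ; zero; suc; _+_; _≤_; _<_; _≤?_; z≤n; s≤s; NonZero)
open import Data.Nat.Properties using (≤-trans; anyUpTo?) renaming (_≟_ to _≟ⁿ_)
open import Data.Product using (∃; ∃₂; _×_; _,_; proj₁; proj₂)
open import Data.Sum using (_⊎_; inj₁; inj₂)
open import Data.Unit using (⊤; tt)
open import Data.Vec using (Vec; []; _∷_; head; last; toList; fromList)
open import Data.Vec.Properties using (toList∘fromList; ≡-dec)
open import Data.Vec.Relation.Unary.All using ([])
open import Data.Vec.Relation.Unary.AllPairs using ([]; _∷_) renaming (allPairs? to allPairsᵛ?)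
open import Data.Vec.Relation.Unary.Linked using (Linked; [-]; linked?)
open import Data.Vec.Relation.Unary.Unique.Propositional using (Unique)
import Data.Vec.Membership.DecPropositional as DecMembership
open import Data.Bool.Properties using () renaming (_≟_ to _≟ᵇ_)
open import Function using (_∘_)
open import Level using (0ℓ)
open import Relation.Binary using (Rel; Symmetric; Irreflexive; Decidable)
open import Relation.Binary.Construct.Add.Supremum.NonStrict _≤_ using (_≤⁺_; ≤⁺-dec; [_])
open import Relation.Binary.PropositionalEquality using (_≡_; _≢_; refl; sym; subst; ≢-sym)
open import Relation.Nullary using (¬_; Dec; yes; no; ¬?; contradiction)
open import Relation.Nullary.Construct.Add.Supremum using (_⁺; [_]) renaming (≡-dec to ≡⁺-dec)
open import Relation.Nullary.Decidable using (map′; _×-dec_; _→-dec_)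
import Relation.Unary as U

private
  variable
    k m n : ℕ

vectors : ∀ {A : Set} → List A → ∀ k → List (Vec A k)
vectors xs zero    = [] ∷ []
vectors xs (suc k) = cartesianProductWith _∷_ xs (vectors xs k)

vectors-complete : ∀ {A : Set} {xs : List A} → (∀ x → x ∈ˡ xs) → (v : Vec A k) → v ∈ˡ vectors xs k
vectors-complete all []      = here refl
vectors-complete all (x ∷ v) = ∈-cartesianProductWith⁺ _∷_ (all x) (vectors-complete all v)

anyVector? : ∀ {A : Set} {xs : List A} → (∀ x → x ∈ˡ xs) →
             {P : U.Pred (Vec A k) 0ℓ} → U.Decidable P → Dec (∃ P)
anyVector? all P? =
  map′ Any.satisfied (λ (v , pv) → lose (vectors-complete all v) pv) (Any.any? P? (vectors _ _))

find-∈ : ∀ {A : Set} {P : U.Pred A 0ℓ} (P? : U.Decidable P) xs {x} → find P? xs ≡ [ x ] → x ∈ˡ xs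
find-∈ P? (y ∷ xs) eq with P? y
find-∈ P? (y ∷ xs) refl | yes _ = here refl
find-∈ P? (y ∷ xs) eq   | no _  = there (find-∈ P? xs eq)

find-head : ∀ {A : Set} {P : U.Pred A 0ℓ} (P? : U.Decidable P) {x} xs → P x → find P? (x ∷ xs) ≡ [ x ]
find-head P? {x} xs px with P? x
... | yes _  = refl
... | no ¬px = contradiction px ¬px

subsets : ∀ n → List (Subset n)
subsets = vectors (outside ∷ inside ∷ [])

subsets-complete : (S : Subset n) → S ∈ˡ subsets n
subsets-complete = vectors-complete λ where
  outside → here refl
  inside  → there (here refl)

-- Equals 0 when no subset satisfies P.
maxCard : {P : U.Pred (Subset n) 0ℓ} → U.Decidable P → ℕ
maxCard P? = max 0 (map ∣_∣ (filter P? (subsets _)))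

∀∈? : (S : Subset n) {P : U.Pred (Fin n) 0ℓ} → U.Decidable P → Dec (∀ u → u ∈ˢ S → P u)
∀∈? S P? = all? λ u → (u ∈ˢ? S) →-dec P? u

_≟ˢ_ : (S T : Subset n) → Dec (S ≡ T)
_≟ˢ_ = ≡-dec _≟ᵇ_

Disjoint : Rel (Subset n) 0ℓ
Disjoint P Q = Empty (P ∩ Q)

disjoint? : Decidable (Disjoint {n})
disjoint? P Q = ¬? (nonempty? (P ∩ Q))

∉⋃ : ∀ {P : Subset n} {x Ps} → x ∈ˢ P → All (Disjoint P) Ps → x ∉ˢ ⋃ Ps
∉⋃ x∈P []                  x∈⊥ = ∉⊥ x∈⊥
∉⋃ x∈P (_∷_ {Q} {Qs} d ds) x∈⋃ with x∈p∪q⁻ Q (⋃ Qs) x∈⋃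
... | inj₁ x∈Q  = d (_ , x∈p∩q⁺ (x∈P , x∈Q))
... | inj₂ x∈⋃′ = ∉⋃ x∈P ds x∈⋃′

length≤∣⋃∣ : {Ps : List (Subset n)} → All Nonempty Ps → AllPairs Disjoint Ps → length Ps ≤ ∣ ⋃ Ps ∣
length≤∣⋃∣ []               []       = z≤n
length≤∣⋃∣ {Ps = P ∷ Ps} ((x , x∈P) ∷ ne) (d ∷ ds) =
  ≤-trans (s≤s (length≤∣⋃∣ ne ds))
          (p⊂q⇒∣p∣<∣q∣ (q⊆p∪q P (⋃ Ps) , x , p⊆p∪q (⋃ Ps) x∈P , ∉⋃ x∈P d))

anyFamily? : {R : U.Pred (List (Subset n)) 0ℓ} → U.Decidable R →
             (∀ {Ps} → R Ps → All Nonempty Ps × AllPairs Disjoint Ps) → Dec (∃ R)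
anyFamily? {n} {R} R? bound = map′ to from
  (anyUpTo? (λ k → anyVector? {k = k} subsets-complete (R? ∘ toList)) (suc n))
  where
  to : (∃ λ k → k < suc n × (∃ λ (v : Vec (Subset n) k) → R (toList v))) → ∃ R
  to (_ , _ , v , r) = toList v , r
  from : ∃ R → ∃ λ k → k < suc n × (∃ λ (v : Vec (Subset n) k) → R (toList v))
  from (Ps , r) = length Ps
    , s≤s (≤-trans (length≤∣⋃∣ (proj₁ (bound r)) (proj₂ (bound r))) (∣p∣≤n (⋃ Ps)))
    , fromList Ps , subst R (sym (toList∘fromList Ps)) r

record Graph (n : ℕ) : Set₁ where
  field
    nonZero : NonZero n
    Adj     : Rel (Fin n) 0ℓ
    adj?    : Decidable Adj
    adjSym  : Symmetric Adj
    irrefl  : Irreflexive _≡_ Adj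

open Graph

complement : Graph n → Graph n
complement G = record
  { nonZero = nonZero G
  ; Adj     = λ u v → u ≢ v × ¬ Adj G u v
  ; adj?    = λ u v → ¬? (u ≟ v) ×-dec ¬? (adj? G u v)
  ; adjSym  = λ (u≢v , ¬uv) → ≢-sym u≢v , ¬uv ∘ adjSym G
  ; irrefl  = λ u≡v (u≢v , _) → u≢v u≡v
  }

JoinAdj : Graph m → Graph n → Rel (Fin m ⊎ Fin n) 0ℓ
JoinAdj G H (inj₁ u) (inj₁ v) = Adj G u v
JoinAdj G H (inj₁ u) (inj₂ v) = ⊤
JoinAdj G H (inj₂ u) (inj₁ v) = ⊤
JoinAdj G H (inj₂ u) (inj₂ v) = Adj H u v

joinAdj? : (G : Graph m) (H : Graph n) → Decidable (JoinAdj G H)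
joinAdj? G H (inj₁ u) (inj₁ v) = adj? G u v
joinAdj? G H (inj₁ u) (inj₂ v) = yes tt
joinAdj? G H (inj₂ u) (inj₁ v) = yes tt
joinAdj? G H (inj₂ u) (inj₂ v) = adj? H u v

joinAdj-sym : (G : Graph m) (H : Graph n) → Symmetric (JoinAdj G H)
joinAdj-sym G H {inj₁ u} {inj₁ v} = adjSym G
joinAdj-sym G H {inj₁ u} {inj₂ v} = λ _ → tt
joinAdj-sym G H {inj₂ u} {inj₁ v} = λ _ → tt
joinAdj-sym G H {inj₂ u} {inj₂ v} = adjSym H

joinAdj-irrefl : (G : Graph m) (H : Graph n) → ∀ x → ¬ JoinAdj G H x x
joinAdj-irrefl G H (inj₁ u) = irrefl G refl
joinAdj-irrefl G H (inj₂ u) = irrefl H refl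

+-nonZero : NonZero m → NonZero (m + n)
+-nonZero {suc m} _ = _

infixl 6 _⊹_

-- The first m vertices of the join are those of G, the last n those of H.
_⊹_ : Graph m → Graph n → Graph (m + n)
_⊹_ {m} G H = record
  { nonZero = +-nonZero (nonZero G)
  ; Adj     = λ x y → JoinAdj G H (splitAt m x) (splitAt m y)
  ; adj?    = λ x y → joinAdj? G H (splitAt m x) (splitAt m y)
  ; adjSym  = λ {x} {y} → joinAdj-sym G H {splitAt m x} {splitAt m y}
  ; irrefl  = λ { {x} refl → joinAdj-irrefl G H (splitAt m x) }
  }

module _ (G : Graph n) where

  open DecMembership (_≟_ {n}) using () renaming (_∈_ to _∈ᵛ_; _∈?_ to _∈ᵛ?_)

  -- Complete subgraphs are identified with their vertex sets.
  IsComplete : Subset n → Set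
  IsComplete S = Nonempty S ×
    (∀ u → u ∈ˢ S → ∀ v → v ∈ˢ S → u ≢ v → Adj G u v)

  isComplete? : U.Decidable IsComplete
  isComplete? S = nonempty? S ×-dec
    ∀∈? S λ u → ∀∈? S λ v → ¬? (u ≟ v) →-dec adj? G u v

  ω : ℕ
  ω = maxCard isComplete?

  Edgeless : Subset n → Set
  Edgeless P = ∀ u → u ∈ˢ P → ∀ v → v ∈ˢ P → ¬ Adj G u v

  CompletelyJoined : Rel (Subset n) 0ℓ
  CompletelyJoined P Q = ∀ u → u ∈ˢ P → ∀ v → v ∈ˢ Q → Adj G u v

  ArePartiteSets : Subset n → List (Subset n) → Set
  ArePartiteSets S Ps =
    2 ≤ length Ps ×
    (All Nonempty Ps × AllPairs Disjoint Ps) × ⋃ Ps ≡ S ×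
    All Edgeless Ps × AllPairs CompletelyJoined Ps

  InducesCompleteMultipartite : Subset n → Set
  InducesCompleteMultipartite S = ∃ λ Ps → ArePartiteSets S Ps

  inducesCompleteMultipartite? : U.Decidable InducesCompleteMultipartite
  inducesCompleteMultipartite? S = anyFamily?
    (λ Ps → (2 ≤? length Ps)
      ×-dec (All.all? nonempty? Ps ×-dec allPairs? disjoint? Ps)
      ×-dec (⋃ Ps ≟ˢ S)
      ×-dec All.all? (λ P → ∀∈? P λ u → ∀∈? P λ v → ¬? (adj? G u v)) Ps
      ×-dec allPairs? (λ P Q → ∀∈? P λ u → ∀∈? Q λ v → adj? G u v) Ps)
    (λ (_ , partition , _) → partition)

  -- A path of length k is given by its k + 1 vertices.
  IsPath : Fin n → Fin n → Vec (Fin n) (suc k) → Set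
  IsPath u v p = head p ≡ u × last p ≡ v × Linked (Adj G) p × Unique p

  isPath? : ∀ u v → U.Decidable (IsPath {k} u v)
  isPath? u v p = (head p ≟ u) ×-dec (last p ≟ v) ×-dec linked? (adj? G) p
    ×-dec allPairsᵛ? (λ x y → ¬? (x ≟ y)) p

  pathOfLength? : ∀ u v k → Dec (∃ λ (p : Vec (Fin n) (suc k)) → IsPath u v p)
  pathOfLength? u v k = anyVector? ∈-allFin (isPath? u v)

  -- The least k such that there is a u,v-path of length k, and ⊤⁺ (infinity) if
  -- there is no path. The search stops at n because the vertices of a path are
  -- distinct, so its length is less than n.
  d : Fin n → Fin n → ℕ ⁺
  d u v = find (pathOfLength? u v) (upTo n)

  Independent : Rel (Subset n) 0ℓ
  Independent Q Q′ = ∀ u → u ∈ˢ Q → ∀ u′ → u′ ∈ˢ Q′ → [ 2 ] ≤⁺ d u u′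

  independent? : Decidable Independent
  independent? Q Q′ = ∀∈? Q λ u → ∀∈? Q′ λ u′ → ≤⁺-dec _≤?_ [ 2 ] (d u u′)

  IsUnionOfIndependentComplete : Subset n → Set
  IsUnionOfIndependentComplete S = ∃ λ Qs →
    1 ≤ length Qs × All IsComplete Qs × AllPairs Independent Qs × ⋃ Qs ≡ S

  IsGeodesic : Fin n → Fin n → Vec (Fin n) (suc k) → Set
  IsGeodesic {k} u v p = IsPath u v p × d u v ≡ [ k ]

  LiesOnGeodesic : Fin n → Fin n → Fin n → Set
  LiesOnGeodesic w u v = ∃₂ λ k (p : Vec (Fin n) (suc k)) → IsGeodesic u v p × w ∈ᵛ p

  liesOnGeodesic? : ∀ w u v → Dec (LiesOnGeodesic w u v)
  liesOnGeodesic? w u v = map′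
    (λ (k , _ , p , q) → k , p , q)
    (λ (k , p , q) → k , d<n (proj₂ (proj₁ q)) , p , q)
    (anyUpTo? (λ k → anyVector? ∈-allFin λ p →
      (isPath? u v p ×-dec ≡⁺-dec _≟ⁿ_ (d u v) [ k ]) ×-dec (w ∈ᵛ? p)) n)
    where
    d<n : d u v ≡ [ k ] → k < n
    d<n = ∈-upTo⁻ ∘ find-∈ (pathOfLength? u v) (upTo n)

  IsGeneralPosition : Subset n → Set
  IsGeneralPosition S = ∀ u → u ∈ˢ S → ∀ v → v ∈ˢ S → u ≢ v →
    ∀ w → w ∈ˢ S → w ≢ u → w ≢ v → ¬ LiesOnGeodesic w u v

  isGeneralPosition? : U.Decidable IsGeneralPosition
  isGeneralPosition? S = ∀∈? S λ u → ∀∈? S λ v → ¬? (u ≟ v) →-dec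
    ∀∈? S λ w → ¬? (w ≟ u) →-dec (¬? (w ≟ v) →-dec ¬? (liesOnGeodesic? w u v))

  gp : ℕ
  gp = maxCard isGeneralPosition?

d-refl : (G : Graph n) (u : Fin n) → d G u u ≡ [ 0 ]
d-refl {suc n} G u = find-head (pathOfLength? G u u) (applyUpTo suc n)
  (u ∷ [] , refl , refl , [-] , [] ∷ [])

independent⇒disjoint : (G : Graph n) {Q Q′ : Subset n} → Independent G Q Q′ → Disjoint Q Q′
independent⇒disjoint G {Q} {Q′} ind (x , x∈Q∩Q′) with x∈p∩q⁻ Q Q′ x∈Q∩Q′
... | x∈Q , x∈Q′ with subst ([ 2 ] ≤⁺_) (d-refl G x) (ind x x∈Q x x∈Q′)
... | [ () ]

isUnionOfIndependentComplete? : (G : Graph n) → U.Decidable (IsUnionOfIndependentComplete G)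
isUnionOfIndependentComplete? G S = anyFamily?
  (λ Qs → (1 ≤? length Qs) ×-dec All.all? (isComplete? G) Qs
    ×-dec allPairs? (independent? G) Qs ×-dec (⋃ Qs ≟ˢ S))
  (λ (_ , complete , independent , _) →
    All.map proj₁ complete , AllPairs.map (independent⇒disjoint G) independent)

η : Graph n → ℕ
η G = maxCard (inducesCompleteMultipartite? (complement G))

ρ : Graph n → ℕ
ρ G = maxCard (isUnionOfIndependentComplete? G)

{-# OPTIONS --safe #-}

-- Distances in G + H are at most 2, so S is in general position iff it contains
-- no induced path on three vertices, that is, iff S induces a disjoint union of
-- cliques. Such a set meeting both V(G) and V(H) is a clique of G + H, hence the
-- union of a clique of G and one of H. A set inside V(G) is a union of pairwise
-- independent cliques of G; if there are at least two, they are the partite sets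
-- of a complete multipartite subgraph of the complement, and if there is only
-- one, ω(G) bounds its size.
module Submission where

open import Defs
open import Data.Bool using (true)
open import Data.Empty using (⊥-elim)
open import Data.Fin using (Fin; zero; splitAt; join; _↑ˡ_; _↑ʳ_)
open import Data.Fin.Properties
  using (_≟_; injective⇒≤; splitAt-join; join-splitAt; splitAt-↑ˡ; splitAt-↑ʳ)
open import Data.Fin.Subset using (Subset; inside; outside; ∣_∣; Nonempty; Empty; ⊥; ⋃; _∪_; _⊂_)
  renaming (_∈_ to _∈ˢ_)
open import Data.Fin.Subset.Induction using (⊂-wellFounded; Acc; acc)
open import Data.Fin.Subset.Properties
  using (nonempty?; ∉⊥; ∣⊥∣≡0; Empty-unique; p⊆p∪q; q⊆p∪q; x∈p∪q⁻; x∈p∪q⁺; ∪-identityʳ; ⊆-antisym)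
  renaming (_∈?_ to _∈ˢ?_)
open import Data.List using (List; []; _∷_; map; filter; find; upTo)
open import Data.List.Extrema.Nat using (xs≤max; argmax-sel)
open import Data.List.Membership.Propositional using (lose) renaming (_∈_ to _∈ˡ_)
open import Data.List.Membership.Propositional.Properties
  using (∈-filter⁺; ∈-filter⁻; ∈-map⁺; ∈-map⁻; ∈-upTo⁺)
open import Data.List.Relation.Unary.All as All using (All; []; _∷_)
open import Data.List.Relation.Unary.AllPairs as AllPairs using (AllPairs; []; _∷_)
open import Data.List.Relation.Unary.AllPairs.Properties using (applyUpTo⁺₁)
open import Data.List.Relation.Unary.Any using (Any; here; there)
open import Data.Maybe using (just; nothing)
open import Data.Nat using (ℕ; zero; suc; _+_; _⊔_; _≤_; _<_; z≤n; s≤s; NonZero)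
open import Data.Nat.Properties
  using (≤-refl; ≤-reflexive; ≤-trans; ≤-antisym; <⇒≤; ≤∧≢⇒<; +-mono-≤; +-identityʳ; m≤m+n; m≤n+m;
         ⊔-lub; ⊔-monoʳ-≤; ⊔-mono-≤; m≤m⊔n; m≤n⊔m; m≤n⇒m≤n⊔o; m≤n⇒m≤o⊔n;
         module ≤-Reasoning)
  renaming (_≟_ to _≟ⁿ_)
open import Data.Product using (∃; _×_; _,_; proj₁; proj₂)
open import Data.Sum using (_⊎_; inj₁; inj₂; [_,_]′)
open import Data.Sum.Properties using (inj₁-injective; inj₂-injective)
open import Data.Unit using (tt)
open import Data.Vec as Vec using (Vec; []; _∷_; _++_; tabulate; lookup)
open import Data.Vec.Properties using (lookup∘tabulate; []=⇒lookup; lookup⇒[]=; lookup-splitAt)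
open import Data.Vec.Relation.Unary.All using ([]; _∷_)
open import Data.Vec.Relation.Unary.AllPairs using ([]; _∷_)
open import Data.Vec.Relation.Unary.Any using (here; there)
open import Data.Vec.Relation.Unary.Linked using ([-]; _∷_)
open import Data.Vec.Relation.Unary.Unique.Propositional using (Unique)
open import Data.Vec.Relation.Unary.Unique.Propositional.Properties using (lookup-injective)
open import Function using (_∘_)
open import Level using (0ℓ)
open import Relation.Binary using (Rel)
open import Relation.Binary.Construct.Add.Supremum.NonStrict _≤_ using (_≤⁺_; [_]; _≤⊤⁺)
open import Relation.Binary.PropositionalEquality
  using (_≡_; _≢_; refl; sym; trans; cong; cong₂; subst; subst₂; ≢-sym)
open import Relation.Nullary using (¬_; Dec; yes; no; ¬?; does; contradiction)
open import Relation.Nullary.Decidable using (dec-true; decidable-stable; _×-dec_; _⊎-dec_)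
import Relation.Unary as U

open Graph

private
  variable
    m n k j b : ℕ

-- Maximum cardinalities, comprehensions and unions of subsets

module _ {P : U.Pred (Subset n) 0ℓ} (P? : U.Decidable P) where

  ∣p∣≤maxCard : ∀ {S} → P S → ∣ S ∣ ≤ maxCard P?
  ∣p∣≤maxCard pS = All.lookup (xs≤max 0 _) (∈-map⁺ ∣_∣ (∈-filter⁺ P? (subsets-complete _) pS))

  -- The first alternative covers a `P` that no subset satisfies, where `maxCard` takes its default
  -- value 0.
  maxCard-attained : maxCard P? ≡ 0 ⊎ ∃ λ S → P S × ∣ S ∣ ≡ maxCard P?
  maxCard-attained with argmax-sel (λ c → c) 0 (map ∣_∣ (filter P? (subsets n)))
  ... | inj₁ eq = inj₁ eq
  ... | inj₂ max∈ with ∈-map⁻ ∣_∣ max∈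
  ...   | S , S∈ , eq = inj₂ (S , proj₂ (∈-filter⁻ P? {xs = subsets n} S∈) , sym eq)

  maxCard≤ : (∀ {S} → P S → ∣ S ∣ ≤ b) → maxCard P? ≤ b
  maxCard≤ {b} bound with maxCard-attained
  ... | inj₁ eq            = subst (_≤ b) (sym eq) z≤n
  ... | inj₂ (S , pS , eq) = subst (_≤ b) eq (bound pS)

∣++∣ : (A : Subset m) (B : Subset n) → ∣ A ++ B ∣ ≡ ∣ A ∣ + ∣ B ∣
∣++∣ []            B = refl
∣++∣ (outside ∷ A) B = ∣++∣ A B
∣++∣ (inside  ∷ A) B = cong suc (∣++∣ A B)

empty⇒∣p∣≡0 : {p : Subset n} → Empty p → ∣ p ∣ ≡ 0
empty⇒∣p∣≡0 {n} empty = trans (cong ∣_∣ (Empty-unique empty)) (∣⊥∣≡0 n)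

module _ {P : U.Pred (Fin n) 0ℓ} (P? : U.Decidable P) where

  comprehension : Subset n
  comprehension = tabulate (does ∘ P?)

  ∈-comprehension⁺ : ∀ {x} → P x → x ∈ˢ comprehension
  ∈-comprehension⁺ {x} px =
    lookup⇒[]= x _ (trans (lookup∘tabulate (does ∘ P?) x) (dec-true (P? x) px))

  ∈-comprehension⁻ : ∀ {x} → x ∈ˢ comprehension → P x
  ∈-comprehension⁻ {x} x∈ = does⇒ (trans (sym (lookup∘tabulate (does ∘ P?) x)) ([]=⇒lookup x∈))
    where
    does⇒ : does (P? x) ≡ true → P x
    does⇒ eq with P? x
    does⇒ eq | yes px = px
    does⇒ () | no _

x∈⋃⁺ : ∀ {x : Fin n} {Ps} → Any (x ∈ˢ_) Ps → x ∈ˢ ⋃ Ps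
x∈⋃⁺ {Ps = _ ∷ Ps} (here x∈P) = p⊆p∪q (⋃ Ps) x∈P
x∈⋃⁺ {Ps = P ∷ Ps} (there x∈) = q⊆p∪q P (⋃ Ps) (x∈⋃⁺ x∈)

x∈⋃⁻ : ∀ {x : Fin n} Ps → x ∈ˢ ⋃ Ps → Any (x ∈ˢ_) Ps
x∈⋃⁻ []       x∈ = contradiction x∈ ∉⊥
x∈⋃⁻ (P ∷ Ps) x∈ with x∈p∪q⁻ P (⋃ Ps) x∈
... | inj₁ x∈P = here x∈P
... | inj₂ x∈⋃ = there (x∈⋃⁻ Ps x∈⋃)

-- Shortest paths

module _ {A : Set} {P : U.Pred A 0ℓ} (P? : U.Decidable P) where

  find-just⇒P : ∀ xs {x} → find P? xs ≡ just x → P x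
  find-just⇒P (y ∷ xs) eq with P? y
  find-just⇒P (y ∷ xs) refl | yes py = py
  find-just⇒P (y ∷ xs) eq   | no _   = find-just⇒P xs eq

  find-succeeds : ∀ {xs x} → x ∈ˡ xs → P x → ∃ λ y → find P? xs ≡ just y
  find-succeeds {y ∷ xs} x∈ px with P? y
  ... | yes _ = y , refl
  find-succeeds (here refl) px | no ¬py = contradiction px ¬py
  find-succeeds (there x∈)  px | no _   = find-succeeds x∈ px

-- `find` returns the first hit, and in a sorted list all later hits are at least as large.
find-minimal : {P : U.Pred ℕ 0ℓ} (P? : U.Decidable P) → ∀ {xs} → AllPairs _≤_ xs →
               find P? xs ≡ just k → j ∈ˡ xs → P j → k ≤ j
find-minimal P? {y ∷ xs} (y≤ ∷ s) eq j∈ pj with P? y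
find-minimal P? (y≤ ∷ s) refl (here refl) pj | yes _  = ≤-refl
find-minimal P? (y≤ ∷ s) refl (there j∈)  pj | yes _  = All.lookup y≤ j∈
find-minimal P? (y≤ ∷ s) eq   (here refl) pj | no ¬py = contradiction pj ¬py
find-minimal P? (y≤ ∷ s) eq   (there j∈)  pj | no _   = find-minimal P? s eq j∈ pj

unique⇒length≤ : (p : Vec (Fin n) k) → Unique p → k ≤ n
unique⇒length≤ p unique = injective⇒≤ {f = lookup p} (lookup-injective unique _ _)

module _ (G : Graph n) where

  -- The `k + 1` vertices are distinct, so `suc k ≤ n`. Hence every path length occurs in the list
  -- `upTo n` that `d` searches.
  path⇒length<n : ∀ {u v} {p : Vec (Fin n) (suc k)} → IsPath G u v p → k < n
  path⇒length<n {p = p} (_ , _ , _ , unique) = unique⇒length≤ p unique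

  d≡⇒path : ∀ {u v} → d G u v ≡ just k → ∃ λ (p : Vec (Fin n) (suc k)) → IsPath G u v p
  d≡⇒path {u = u} {v} = find-just⇒P (pathOfLength? G u v) (upTo n)

  d-minimal : ∀ {u v} {p : Vec (Fin n) (suc j)} → d G u v ≡ just k → IsPath G u v p → k ≤ j
  d-minimal {u = u} {v} eq path =
    find-minimal (pathOfLength? G u v) (applyUpTo⁺₁ _ n (λ i<j _ → <⇒≤ i<j)) eq
      (∈-upTo⁺ (path⇒length<n path)) (_ , path)

  -- The given path makes the search succeed at some `j`. Minimality yields `j ≤ k`, and `j < k`
  -- would produce a shorter path.
  d≡length : ∀ {u v} {p : Vec (Fin n) (suc k)} → IsPath G u v p →
             (∀ {j} {q : Vec (Fin n) (suc j)} → j < k → ¬ IsPath G u v q) → d G u v ≡ just k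
  d≡length {k = k} {u = u} {v} path noShorter
    with find-succeeds (pathOfLength? G u v) (∈-upTo⁺ (path⇒length<n path)) (_ , path)
  ... | j , eq with j ≟ⁿ k
  ...   | yes refl = eq
  ...   | no j≢k   = contradiction (proj₂ (d≡⇒path eq)) (noShorter (≤∧≢⇒< (d-minimal eq path) j≢k))

  path₀⇒≡ : ∀ {u v} {p : Vec (Fin n) 1} → IsPath G u v p → u ≡ v
  path₀⇒≡ {p = _ ∷ []} (refl , refl , _) = refl

  path₁⇒adj : ∀ {u v} {p : Vec (Fin n) 2} → IsPath G u v p → Adj G u v
  path₁⇒adj {p = _ ∷ _ ∷ []} (refl , refl , uv ∷ _ , _) = uv

  adj⇒≢ : ∀ {u v} → Adj G u v → u ≢ v
  adj⇒≢ uv u≡v = irrefl G u≡v uv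

  adj⇒path₁ : ∀ {u v} → Adj G u v → IsPath G u v (u ∷ v ∷ [])
  adj⇒path₁ uv = refl , refl , uv ∷ [-] , (adj⇒≢ uv ∷ []) ∷ [] ∷ []

  adj²⇒path₂ : ∀ {u w v} → Adj G u w → Adj G w v → u ≢ v → IsPath G u v (u ∷ w ∷ v ∷ [])
  adj²⇒path₂ uw wv u≢v =
    refl , refl , uw ∷ wv ∷ [-] , (adj⇒≢ uw ∷ u≢v ∷ []) ∷ (adj⇒≢ wv ∷ []) ∷ [] ∷ []

  adj⇒d≡1 : ∀ {u v} → Adj G u v → d G u v ≡ just 1
  adj⇒d≡1 uv = d≡length (adj⇒path₁ uv) λ where
    (s≤s z≤n) path → adj⇒≢ uv (path₀⇒≡ path)

  adj²⇒d≡2 : ∀ {u w v} → Adj G u w → Adj G w v → u ≢ v → ¬ Adj G u v → d G u v ≡ just 2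
  adj²⇒d≡2 uw wv u≢v ¬uv = d≡length (adj²⇒path₂ uw wv u≢v) λ where
    (s≤s z≤n)       path → u≢v (path₀⇒≡ path)
    (s≤s (s≤s z≤n)) path → ¬uv (path₁⇒adj path)

  -- Distance at least 2, stated without distances: the vertices are distinct and not adjacent. In
  -- this form it is literally the condition between two partite sets in the complement.
  Separated : Rel (Subset n) 0ℓ
  Separated = CompletelyJoined (complement G)

  independent⇒separated : ∀ {P Q} → Independent G P Q → Separated P Q
  independent⇒separated ind u u∈P v v∈Q = u≢v , ¬uv
    where
    u≢v : u ≢ v
    u≢v refl with subst (just 2 ≤⁺_) (d-refl G u) (ind u u∈P v v∈Q)
    ... | [ () ]
    ¬uv : ¬ Adj G u v
    ¬uv uv with subst (just 2 ≤⁺_) (adj⇒d≡1 uv) (ind u u∈P v v∈Q)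
    ... | [ s≤s () ]

  separated⇒independent : ∀ {P Q} → Separated P Q → Independent G P Q
  separated⇒independent sep u u∈P v v∈Q with d G u v in eq
  ... | nothing            = just 2 ≤⊤⁺
  ... | just 0             = contradiction (path₀⇒≡ (proj₂ (d≡⇒path eq))) (proj₁ (sep u u∈P v v∈Q))
  ... | just 1             = contradiction (path₁⇒adj (proj₂ (d≡⇒path eq))) (proj₂ (sep u u∈P v v∈Q))
  ... | just (suc (suc _)) = [ s≤s (s≤s z≤n) ]

-- Cluster sets

  -- With the symmetry of adjacency, this makes "equal or adjacent" an equivalence relation on `S`,
  -- whose classes are cliques.
  IsCluster : Subset n → Set
  IsCluster S = ∀ {u w v} → u ∈ˢ S → w ∈ˢ S → v ∈ˢ S →
                Adj G u w → Adj G w v → u ≢ v → Adj G u v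

  -- If `u` and `v` were not adjacent, `u`, `w`, `v` would be a geodesic of length 2 with all three
  -- vertices in `S`.
  generalPosition⇒cluster : ∀ {S} → IsGeneralPosition G S → IsCluster S
  generalPosition⇒cluster gpS {u} {w} {v} u∈S w∈S v∈S uw wv u≢v =
    decidable-stable (adj? G u v) λ ¬uv →
      gpS u u∈S v v∈S u≢v w w∈S (≢-sym (adj⇒≢ uw)) (adj⇒≢ wv)
        (2 , u ∷ w ∷ v ∷ [] , (adj²⇒path₂ uw wv u≢v , adj²⇒d≡2 uw wv u≢v ¬uv) , there (here refl))

  -- For `u ≡ v` this asks for a neighbour of `u`, which a join of nonempty graphs always provides.
  Diameter≤2 : Set
  Diameter≤2 = ∀ u v → Adj G u v ⊎ ∃ λ w → Adj G u w × Adj G w v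

  -- Geodesics of length 0 or 1 have no inner vertex, and length 3 or more contradicts the diameter.
  -- If `w` is the middle of a geodesic of length 2, the cluster property makes `u` and `v`
  -- adjacent, so their distance is at most 1.
  cluster⇒generalPosition : Diameter≤2 → ∀ {S} → IsCluster S → IsGeneralPosition G S
  cluster⇒generalPosition diam {S} cluster u u∈S v v∈S u≢v w w∈S w≢u w≢v = λ where
      (0 , _ , (path , _) , _) → u≢v (path₀⇒≡ path)
      (1 , _ ∷ _ ∷ [] , ((refl , _) , _) , here refl)             → w≢u refl
      (1 , _ ∷ _ ∷ [] , ((_ , refl , _) , _) , there (here refl)) → w≢v refl
      (2 , _ ∷ _ ∷ _ ∷ [] , ((refl , _) , _) , here refl)                     → w≢u refl
      (2 , _ ∷ _ ∷ _ ∷ [] , ((_ , refl , _) , _) , there (there (here refl))) → w≢v refl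
      (2 , _ ∷ _ ∷ _ ∷ [] , ((refl , refl , uw ∷ wv ∷ [-] , _) , eq) , there (here refl)) →
        contradiction (d-minimal eq (adj⇒path₁ (cluster u∈S w∈S v∈S uw wv u≢v))) λ { (s≤s ()) }
      (suc (suc (suc _)) , _ , (_ , eq) , _) → far eq (diam u v)
    where
    far : ∀ {k} → d G u v ≡ just (3 + k) → ¬ (Adj G u v ⊎ ∃ λ w → Adj G u w × Adj G w v)
    far eq (inj₁ uv) with d-minimal eq (adj⇒path₁ uv)
    ... | s≤s ()
    far eq (inj₂ (_ , ux , xv)) with d-minimal eq (adj²⇒path₂ ux xv u≢v)
    ... | s≤s (s≤s ())

  -- No edge joins `P` to `R`, so the three vertices `u`, `w`, `v` lie in the same one of the two
  -- sets.
  cluster-∪ : ∀ {P R} → IsComplete G P → IsCluster R → Separated P R → IsCluster (P ∪ R)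
  cluster-∪ {P} {R} (_ , complete) cluster sep u∈ w∈ v∈ uw wv u≢v
    with x∈p∪q⁻ P R u∈ | x∈p∪q⁻ P R w∈ | x∈p∪q⁻ P R v∈
  ... | inj₁ u∈P | inj₁ w∈P | inj₁ v∈P = complete _ u∈P _ v∈P u≢v
  ... | inj₁ u∈P | inj₁ w∈P | inj₂ v∈R = contradiction wv (proj₂ (sep _ w∈P _ v∈R))
  ... | inj₁ u∈P | inj₂ w∈R | _        = contradiction uw (proj₂ (sep _ u∈P _ w∈R))
  ... | inj₂ u∈R | inj₁ w∈P | _        = contradiction (adjSym G uw) (proj₂ (sep _ w∈P _ u∈R))
  ... | inj₂ u∈R | inj₂ w∈R | inj₁ v∈P = contradiction (adjSym G wv) (proj₂ (sep _ v∈P _ w∈R))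
  ... | inj₂ u∈R | inj₂ w∈R | inj₂ v∈R = cluster u∈R w∈R v∈R uw wv u≢v

  ⋃-cluster : ∀ {Qs} → All (IsComplete G) Qs → AllPairs Separated Qs → IsCluster (⋃ Qs)
  ⋃-cluster []       []         u∈ = contradiction u∈ ∉⊥
  ⋃-cluster (c ∷ cs) (sep ∷ seps) =
    cluster-∪ c (⋃-cluster cs seps) λ u u∈Q v v∈⋃ →
      All.lookupWith (λ s v∈Q′ → s u u∈Q v v∈Q′) sep (x∈⋃⁻ _ v∈⋃)

  -- The list may be empty, to cover the empty set. Since `ρ` requires at least one set and `η` at
  -- least two, later proofs split on its length.
  ClusterDecomposition : Subset n → Set
  ClusterDecomposition S = ∃ λ Qs → All (IsComplete G) Qs × AllPairs Separated Qs × ⋃ Qs ≡ S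

  -- Split off the closed neighbourhood, within S, of some x ∈ S.
  decompose : ∀ {S} → Acc _⊂_ S → IsCluster S → ClusterDecomposition S
  decompose {S} (acc rec) cluster with nonempty? S
  ... | no empty = [] , [] , [] , sym (Empty-unique empty)
  ... | yes (x , x∈S) = Q ∷ Qs , completeQ ∷ completeQs , sepQ ∷ sepQs , Q∪⋃Qs≡S
    where
    near? : ∀ u → Dec (u ≡ x ⊎ Adj G u x)
    near? u = (u ≟ x) ⊎-dec adj? G u x

    inQ? : ∀ u → Dec (u ∈ˢ S × (u ≡ x ⊎ Adj G u x))
    inQ? u = (u ∈ˢ? S) ×-dec near? u

    inR? : ∀ u → Dec (u ∈ˢ S × ¬ (u ≡ x ⊎ Adj G u x))
    inR? u = (u ∈ˢ? S) ×-dec ¬? (near? u)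

    Q R : Subset n
    Q = comprehension inQ?
    R = comprehension inR?

    ∈Q⁻ : ∀ {u} → u ∈ˢ Q → u ∈ˢ S × (u ≡ x ⊎ Adj G u x)
    ∈Q⁻ = ∈-comprehension⁻ inQ?

    ∈R⁻ : ∀ {u} → u ∈ˢ R → u ∈ˢ S × ¬ (u ≡ x ⊎ Adj G u x)
    ∈R⁻ = ∈-comprehension⁻ inR?

    R⊂S : R ⊂ S
    R⊂S = proj₁ ∘ ∈R⁻ , x , x∈S , λ x∈R → proj₂ (∈R⁻ x∈R) (inj₁ refl)

    clusterR : IsCluster R
    clusterR u∈R w∈R v∈R = cluster (proj₁ (∈R⁻ u∈R)) (proj₁ (∈R⁻ w∈R)) (proj₁ (∈R⁻ v∈R))

    completeQ : IsComplete G Q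
    completeQ = (x , ∈-comprehension⁺ inQ? (x∈S , inj₁ refl)) , adjacent
      where
      adjacent : ∀ u → u ∈ˢ Q → ∀ v → v ∈ˢ Q → u ≢ v → Adj G u v
      adjacent u u∈Q v v∈Q u≢v with ∈Q⁻ u∈Q | ∈Q⁻ v∈Q
      ... | _ , inj₁ refl   | _ , inj₁ refl   = contradiction refl u≢v
      ... | _ , inj₁ refl   | _ , inj₂ vx     = adjSym G vx
      ... | _ , inj₂ ux     | _ , inj₁ refl   = ux
      -- Two neighbours of `x` are joined by the path `u`, `x`, `v`.
      ... | u∈S , inj₂ ux   | v∈S , inj₂ vx   = cluster u∈S x∈S v∈S ux (adjSym G vx) u≢v

    separatedQR : Separated Q R
    separatedQR u u∈Q v v∈R with ∈Q⁻ u∈Q | ∈R⁻ v∈R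
    ... | u∈S , near | v∈S , ¬near = (λ { refl → ¬near near }) , ¬uv near
      where
      ¬uv : u ≡ x ⊎ Adj G u x → ¬ Adj G u v
      ¬uv (inj₁ refl) uv = ¬near (inj₂ (adjSym G uv))
      -- An edge from `u` to `v` would give the path `v`, `u`, `x` and put `v` into the
      -- neighbourhood of `x`.
      ¬uv (inj₂ ux)   uv = ¬near (inj₂ (cluster v∈S u∈S x∈S (adjSym G uv) ux (¬near ∘ inj₁)))

    decompositionR : ClusterDecomposition R
    decompositionR = decompose (rec R⊂S) clusterR

    Qs : List (Subset n)
    Qs = proj₁ decompositionR

    completeQs : All (IsComplete G) Qs
    completeQs = proj₁ (proj₂ decompositionR)

    sepQs : AllPairs Separated Qs
    sepQs = proj₁ (proj₂ (proj₂ decompositionR))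

    ⋃Qs≡R : ⋃ Qs ≡ R
    ⋃Qs≡R = proj₂ (proj₂ (proj₂ decompositionR))

    sepQ : All (Separated Q) Qs
    sepQ = All.tabulate λ Q′∈Qs u u∈Q v v∈Q′ →
      separatedQR u u∈Q v (subst (_ ∈ˢ_) ⋃Qs≡R (x∈⋃⁺ (lose Q′∈Qs v∈Q′)))

    Q∪⋃Qs≡S : Q ∪ ⋃ Qs ≡ S
    Q∪⋃Qs≡S = trans (cong (Q ∪_) ⋃Qs≡R) (⊆-antisym
      (λ u∈ → [ proj₁ ∘ ∈Q⁻ , proj₁ ∘ ∈R⁻ ]′ (x∈p∪q⁻ Q R u∈))
      split)
      where
      split : ∀ {u} → u ∈ˢ S → u ∈ˢ Q ∪ R
      split {u} u∈S with near? u
      ... | yes near = x∈p∪q⁺ (inj₁ (∈-comprehension⁺ inQ? (u∈S , near)))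
      ... | no ¬near = x∈p∪q⁺ (inj₂ (∈-comprehension⁺ inR? (u∈S , ¬near)))

  cluster⇒decomposition : ∀ {S} → IsCluster S → ClusterDecomposition S
  cluster⇒decomposition = decompose (⊂-wellFounded _)

-- Clusters and the invariants ω, ρ and η

  -- Unlike `IsComplete`, this admits the empty set, which realises the default value 0 in
  -- `ω-attained`.
  Pairwise : Subset n → Set
  Pairwise S = ∀ {u v} → u ∈ˢ S → v ∈ˢ S → u ≢ v → Adj G u v

  pairwise⇒∣∣≤ω : ∀ {S} → Pairwise S → ∣ S ∣ ≤ ω G
  pairwise⇒∣∣≤ω {S} pairwise with nonempty? S
  ... | yes ne   = ∣p∣≤maxCard (isComplete? G) (ne , λ u u∈S v v∈S → pairwise u∈S v∈S)
  ... | no empty = subst (_≤ ω G) (sym (empty⇒∣p∣≡0 empty)) z≤n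

  ω-attained : ∃ λ S → Pairwise S × ∣ S ∣ ≡ ω G
  ω-attained with maxCard-attained (isComplete? G)
  ... | inj₁ eq                      = ⊥ , (λ u∈⊥ → contradiction u∈⊥ ∉⊥) , trans (∣⊥∣≡0 n) (sym eq)
  ... | inj₂ (S , (_ , complete) , eq) = S , (λ u∈S v∈S → complete _ u∈S _ v∈S) , eq

  cluster⇒∣∣≤ρ : ∀ {S} → IsCluster S → ∣ S ∣ ≤ ρ G
  cluster⇒∣∣≤ρ {S} = bound ∘ cluster⇒decomposition
    where
    bound : ClusterDecomposition S → ∣ S ∣ ≤ ρ G
    bound ([] , _ , _ , refl) = ≤-trans (≤-reflexive (∣⊥∣≡0 n)) z≤n
    bound (Q ∷ Qs , complete , separated , eq) = ∣p∣≤maxCard (isUnionOfIndependentComplete? G)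
      (Q ∷ Qs , s≤s z≤n , complete , AllPairs.map separated⇒independent separated , eq)

  cluster⇒∣∣≤ω⊔η : ∀ {S} → IsCluster S → ∣ S ∣ ≤ ω G ⊔ η G
  cluster⇒∣∣≤ω⊔η {S} = bound ∘ cluster⇒decomposition
    where
    bound : ClusterDecomposition S → ∣ S ∣ ≤ ω G ⊔ η G
    bound ([] , _ , _ , refl) = ≤-trans (≤-reflexive (∣⊥∣≡0 n)) z≤n
    bound (Q ∷ [] , (_ , complete) ∷ [] , _ , eq) =
      -- The union of the one-element list unfolds to `Q ∪ ⊥`, hence the identity law.
      m≤n⇒m≤n⊔o (η G) (subst (λ T → ∣ T ∣ ≤ ω G) (trans (sym (∪-identityʳ Q)) eq)
        (pairwise⇒∣∣≤ω λ u∈Q v∈Q → complete _ u∈Q _ v∈Q))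
    -- In the complement, cliques become edgeless sets and separated sets become completely joined.
    bound (Qs@(_ ∷ _ ∷ _) , complete , separated , eq) =
      m≤n⇒m≤o⊔n (ω G) (∣p∣≤maxCard (inducesCompleteMultipartite? (complement G))
        ( Qs , s≤s (s≤s z≤n)
        , (All.map proj₁ complete ,
           AllPairs.map (independent⇒disjoint G ∘ separated⇒independent) separated)
        , eq
        , All.map (λ (_ , adj) u u∈P v v∈P (u≢v , ¬uv) → ¬uv (adj u u∈P v v∈P u≢v)) complete
        , separated))

  ρ≤ : (∀ {S} → IsCluster S → ∣ S ∣ ≤ b) → ρ G ≤ b
  ρ≤ bound = maxCard≤ (isUnionOfIndependentComplete? G) λ where
    (_ , _ , complete , independent , refl) →
      bound (⋃-cluster complete (AllPairs.map independent⇒separated independent))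

  -- A nonempty edgeless set of the complement is a clique of `G`; decidability of adjacency removes
  -- the double negation. Complete joining in the complement is separation in `G`, so the union of
  -- the partite sets is a cluster.
  η≤ : (∀ {S} → IsCluster S → ∣ S ∣ ≤ b) → η G ≤ b
  η≤ bound = maxCard≤ (inducesCompleteMultipartite? (complement G)) λ where
    (_ , _ , (nonempty , _) , refl , edgeless , joined) →
      bound (⋃-cluster
        (All.zipWith (λ (ne , edgeless) → ne , λ u u∈P v v∈P u≢v →
          decidable-stable (adj? G u v) λ ¬uv → edgeless u u∈P v v∈P (u≢v , ¬uv)) (nonempty , edgeless))
        joined)

-- Joins

vertex : Graph n → Fin n
vertex {zero}  G = ⊥-elim (NonZero.nonZero (nonZero G))
vertex {suc _} G = zero

-- Vertices on the same side have every vertex of the other side as a common neighbour, and that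
-- side is nonempty.
⊹-diameter≤2 : (G : Graph m) (H : Graph n) → Diameter≤2 (G ⊹ H)
⊹-diameter≤2 {m} {n} G H u v with splitAt m u | splitAt m v
... | inj₁ _ | inj₂ _ = inj₁ tt
... | inj₂ _ | inj₁ _ = inj₁ tt
... | inj₁ a | inj₁ b = inj₂ (m ↑ʳ vertex H , via)
  where
  via : JoinAdj G H (inj₁ a) (splitAt m (m ↑ʳ vertex H)) × JoinAdj G H (splitAt m (m ↑ʳ vertex H)) (inj₁ b)
  via rewrite splitAt-↑ʳ m n (vertex H) = tt , tt
... | inj₂ a | inj₂ b = inj₂ (vertex G ↑ˡ n , via)
  where
  via : JoinAdj G H (inj₂ a) (splitAt m (vertex G ↑ˡ n)) × JoinAdj G H (splitAt m (vertex G ↑ˡ n)) (inj₂ b)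
  via rewrite splitAt-↑ˡ m (vertex G) n = tt , tt

module _ (A : Subset m) (B : Subset n) where

  _∈ʲ : Fin m ⊎ Fin n → Set
  x ∈ʲ = [ _∈ˢ A , _∈ˢ B ]′ x

  ∈-++⁻ : ∀ {x} → x ∈ˢ A ++ B → splitAt m x ∈ʲ
  ∈-++⁻ {x} x∈ with splitAt m x | trans (sym (lookup-splitAt m A B x)) ([]=⇒lookup x∈)
  ... | inj₁ a | eq = lookup⇒[]= a A eq
  ... | inj₂ b | eq = lookup⇒[]= b B eq

  ∈-++⁺ : ∀ {x} → splitAt m x ∈ʲ → x ∈ˢ A ++ B
  ∈-++⁺ {x} x∈ = lookup⇒[]= x _ (trans (lookup-splitAt m A B x) (inside′ (splitAt m x) x∈))
    where
    inside′ : ∀ y → y ∈ʲ → [ lookup A , lookup B ]′ y ≡ inside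
    inside′ (inj₁ a) a∈A = []=⇒lookup a∈A
    inside′ (inj₂ b) b∈B = []=⇒lookup b∈B

module _ (G : Graph m) (H : Graph n) where

  -- The cluster property of the join carried over to `Fin m ⊎ Fin n`, where matching on the sides
  -- lets `JoinAdj` compute.
  IsJoinCluster : Subset m → Subset n → Set
  IsJoinCluster A B = ∀ x y z → _∈ʲ A B x → _∈ʲ A B y → _∈ʲ A B z →
                      JoinAdj G H x y → JoinAdj G H y z → x ≢ z → JoinAdj G H x z

  cluster⇒joinCluster : ∀ {A B} → IsCluster (G ⊹ H) (A ++ B) → IsJoinCluster A B
  cluster⇒joinCluster {A} {B} cluster x y z x∈ y∈ z∈ xy yz x≢z =
    subst₂ (JoinAdj G H) (s x) (s z)
      (cluster (mem x x∈) (mem y y∈) (mem z z∈) (adj x y xy) (adj y z yz) (x≢z ∘ join-injective x z))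
    where
    s : ∀ x → splitAt m (join m n x) ≡ x
    s = splitAt-join m n
    mem : ∀ x → _∈ʲ A B x → join m n x ∈ˢ A ++ B
    mem x x∈ = ∈-++⁺ A B (subst (_∈ʲ A B) (sym (s x)) x∈)
    adj : ∀ x y → JoinAdj G H x y → Adj (G ⊹ H) (join m n x) (join m n y)
    adj x y = subst₂ (JoinAdj G H) (sym (s x)) (sym (s y))
    join-injective : ∀ x y → join m n x ≡ join m n y → x ≡ y
    join-injective x y eq = trans (sym (s x)) (trans (cong (splitAt m) eq) (s y))

  joinCluster⇒cluster : ∀ {A B} → IsJoinCluster A B → IsCluster (G ⊹ H) (A ++ B)
  joinCluster⇒cluster {A} {B} cluster {x} {y} {z} x∈ y∈ z∈ xy yz x≢z =
    cluster (splitAt m x) (splitAt m y) (splitAt m z) (∈-++⁻ A B x∈) (∈-++⁻ A B y∈) (∈-++⁻ A B z∈) xy yz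
      λ eq → x≢z (trans (sym (join-splitAt m n x)) (trans (cong (join m n) eq) (join-splitAt m n z)))

  joinCluster≤gp : ∀ {A B} → IsJoinCluster A B → ∣ A ∣ + ∣ B ∣ ≤ gp (G ⊹ H)
  joinCluster≤gp {A} {B} cluster = subst (_≤ gp (G ⊹ H)) (∣++∣ A B)
    (∣p∣≤maxCard (isGeneralPosition? (G ⊹ H))
      (cluster⇒generalPosition (G ⊹ H) (⊹-diameter≤2 G H) (joinCluster⇒cluster {A} {B} cluster)))

  gp≤ : (∀ {A B} → IsJoinCluster A B → ∣ A ∣ + ∣ B ∣ ≤ b) → gp (G ⊹ H) ≤ b
  gp≤ {b} bound = maxCard≤ (isGeneralPosition? (G ⊹ H)) λ {S} gpS → part S gpS (Vec.splitAt m S)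
    where
    part : ∀ S → IsGeneralPosition (G ⊹ H) S → (∃ λ A → ∃ λ B → S ≡ A ++ B) → ∣ S ∣ ≤ b
    part _ gpS (A , B , refl) = subst (_≤ b) (sym (∣++∣ A B))
      (bound {A} {B} (cluster⇒joinCluster {A} {B} (generalPosition⇒cluster (G ⊹ H) gpS)))

  clusterˡ≤gp : ∀ {A} → IsCluster G A → ∣ A ∣ ≤ gp (G ⊹ H)
  clusterˡ≤gp {A} cluster = ≤-trans (m≤m+n ∣ A ∣ _) (joinCluster≤gp {A} {⊥} λ where
    (inj₁ _) (inj₁ _) (inj₁ _) u∈ w∈ v∈ uw wv u≢v → cluster u∈ w∈ v∈ uw wv (u≢v ∘ cong inj₁)
    (inj₂ _) _ _ u∈⊥ _ _ → contradiction u∈⊥ ∉⊥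
    _ (inj₂ _) _ _ w∈⊥ _ → contradiction w∈⊥ ∉⊥
    _ _ (inj₂ _) _ _ v∈⊥ → contradiction v∈⊥ ∉⊥)

  clusterʳ≤gp : ∀ {B} → IsCluster H B → ∣ B ∣ ≤ gp (G ⊹ H)
  clusterʳ≤gp {B} cluster = ≤-trans (m≤n+m ∣ B ∣ _) (joinCluster≤gp {⊥} {B} λ where
    (inj₂ _) (inj₂ _) (inj₂ _) u∈ w∈ v∈ uw wv u≢v → cluster u∈ w∈ v∈ uw wv (u≢v ∘ cong inj₂)
    (inj₁ _) _ _ u∈⊥ _ _ → contradiction u∈⊥ ∉⊥
    _ (inj₁ _) _ _ w∈⊥ _ → contradiction w∈⊥ ∉⊥
    _ _ (inj₁ _) _ _ v∈⊥ → contradiction v∈⊥ ∉⊥)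

  -- Pairwise adjacent sets attaining `ω` on each side remain pairwise adjacent when united, since
  -- the join adds all edges between the sides.
  ω+ω≤gp : ω G + ω H ≤ gp (G ⊹ H)
  ω+ω≤gp = bound (ω-attained G) (ω-attained H)
    where
    bound : (∃ λ A → Pairwise G A × ∣ A ∣ ≡ ω G) → (∃ λ B → Pairwise H B × ∣ B ∣ ≡ ω H) →
            ω G + ω H ≤ gp (G ⊹ H)
    bound (A , adjA , eqA) (B , adjB , eqB) =
      subst (_≤ gp (G ⊹ H)) (cong₂ _+_ eqA eqB) (joinCluster≤gp {A} {B} λ where
        (inj₁ _) _ (inj₁ _) u∈A _ v∈A _ _ u≢v → adjA u∈A v∈A (u≢v ∘ cong inj₁)
        (inj₁ _) _ (inj₂ _) _ _ _ _ _ _       → tt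
        (inj₂ _) _ (inj₁ _) _ _ _ _ _ _       → tt
        (inj₂ _) _ (inj₂ _) u∈B _ v∈B _ _ u≢v → adjB u∈B v∈B (u≢v ∘ cong inj₂))

  -- The term `ω G`, which accompanies `η G` in the bound for one-sided clusters, is absorbed by
  -- `ω G + ω H`.
  ω⊔η≤ˡ : ω G ⊔ η G ≤ (ω G + ω H) ⊔ (η G ⊔ η H)
  ω⊔η≤ˡ = ⊔-mono-≤ (m≤m+n (ω G) (ω H)) (m≤m⊔n (η G) (η H))

  ω⊔η≤ʳ : ω H ⊔ η H ≤ (ω G + ω H) ⊔ (η G ⊔ η H)
  ω⊔η≤ʳ = ⊔-mono-≤ (m≤n+m (ω H) (ω G)) (m≤n⊔m (η G) (η H))

  joinCluster≤ω+ω⊔η⊔η : ∀ {A B} → IsJoinCluster A B → ∣ A ∣ + ∣ B ∣ ≤ (ω G + ω H) ⊔ (η G ⊔ η H)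
  joinCluster≤ω+ω⊔η⊔η {A} {B} cluster = bound (nonempty? A) (nonempty? B)
    where
    clusterA : IsCluster G A
    clusterA u∈ w∈ v∈ uw wv u≢v =
      cluster (inj₁ _) (inj₁ _) (inj₁ _) u∈ w∈ v∈ uw wv (u≢v ∘ inj₁-injective)

    clusterB : IsCluster H B
    clusterB u∈ w∈ v∈ uw wv u≢v =
      cluster (inj₂ _) (inj₂ _) (inj₂ _) u∈ w∈ v∈ uw wv (u≢v ∘ inj₂-injective)

    bound : Dec (Nonempty A) → Dec (Nonempty B) → ∣ A ∣ + ∣ B ∣ ≤ (ω G + ω H) ⊔ (η G ⊔ η H)
    -- The vertex `b` is adjacent to all of `A`, so the path `u`, `b`, `v` forces any two distinct
    -- vertices of `A` to be adjacent; likewise for `B` with `a`.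
    bound (yes (a , a∈A)) (yes (b , b∈B)) = m≤n⇒m≤n⊔o (η G ⊔ η H) (+-mono-≤
      (pairwise⇒∣∣≤ω G λ u∈A v∈A u≢v →
        cluster (inj₁ _) (inj₂ b) (inj₁ _) u∈A b∈B v∈A tt tt (u≢v ∘ inj₁-injective))
      (pairwise⇒∣∣≤ω H λ u∈B v∈B u≢v →
        cluster (inj₂ _) (inj₁ a) (inj₂ _) u∈B a∈A v∈B tt tt (u≢v ∘ inj₂-injective)))
    bound _ (no empty) = begin
      ∣ A ∣ + ∣ B ∣                  ≡⟨ cong (∣ A ∣ +_) (empty⇒∣p∣≡0 empty) ⟩
      ∣ A ∣ + 0                      ≡⟨ +-identityʳ ∣ A ∣ ⟩
      ∣ A ∣                          ≤⟨ cluster⇒∣∣≤ω⊔η G clusterA ⟩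
      ω G ⊔ η G                      ≤⟨ ω⊔η≤ˡ ⟩
      (ω G + ω H) ⊔ (η G ⊔ η H)      ∎
      where open ≤-Reasoning
    bound (no empty) _ = begin
      ∣ A ∣ + ∣ B ∣                  ≡⟨ cong (_+ ∣ B ∣) (empty⇒∣p∣≡0 empty) ⟩
      ∣ B ∣                          ≤⟨ cluster⇒∣∣≤ω⊔η H clusterB ⟩
      ω H ⊔ η H                      ≤⟨ ω⊔η≤ʳ ⟩
      (ω G + ω H) ⊔ (η G ⊔ η H)      ∎
      where open ≤-Reasoning

-- Comparison of `η` with `ρ`, and the two equalities

η≤ρ : (G : Graph n) → η G ≤ ρ G
η≤ρ G = η≤ G (cluster⇒∣∣≤ρ G)

-- The term `ω G` accounts for single cliques, which count for `ρ` but not for `η`: a complete graph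
-- has `η` equal to 0.
ρ≤ω⊔η : (G : Graph n) → ρ G ≤ ω G ⊔ η G
ρ≤ω⊔η G = ρ≤ G (cluster⇒∣∣≤ω⊔η G)

proposition4p2 : ∀ (m n : ℕ) (G : Graph m) (H : Graph n) →
    gp (G ⊹ H) ≡ (ω G + ω H) ⊔ (η G ⊔ η H) ×
    (ω G + ω H) ⊔ (η G ⊔ η H) ≡ (ω G + ω H) ⊔ (ρ G ⊔ ρ H)
proposition4p2 m n G H =
    ≤-antisym (gp≤ G H (joinCluster≤ω+ω⊔η⊔η G H))
      (⊔-lub (ω+ω≤gp G H) (⊔-lub (η≤ G (clusterˡ≤gp G H)) (η≤ H (clusterʳ≤gp G H))))
  , ≤-antisym (⊔-monoʳ-≤ (ω G + ω H) (⊔-mono-≤ (η≤ρ G) (η≤ρ H)))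
      (⊔-lub (m≤m⊔n (ω G + ω H) (η G ⊔ η H)) (⊔-lub
        (≤-trans (ρ≤ω⊔η G) (ω⊔η≤ˡ G H))
        (≤-trans (ρ≤ω⊔η H) (ω⊔η≤ʳ G H))))
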